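{- As formal power series, $$1+\frac{q^2+q^3}{1-q^2}+\sum_{n\ge2}\frac{(-q^3;q^4)_{n-1}\,q^{2n}(1+q^{2n-1})}{(q^2;q^2)_n}=\prod_{\substack{n\ge1\\ n\not\equiv1,5,6\ (\mathrm{mod}\ 8)}}\frac{1}{1-q^n}.$$
   Context: $(a;q)_n=\prod_{j=0}^{n-1}(1-aq^j)$. -}

module Defs where

open import Algebra.Bundles.Raw using (RawRing)
import Algebra.Definitions.RawSemiring as RawSemiringDefinitions
open import Data.Bool.Base using (if_then_else_)
open import Data.Fin.Base using (toℕ)
open import Data.Integer.Base as ℤ using (ℤ; 0ℤ; 1ℤ)
import Data.Integer.Properties as ℤ
open import Data.Integer.Tactic.RingSolver using (solve-∀)
open import Data.Nat.Base as ℕ using (ℕ; zero; suc; _∸_; _≤_; _%_)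
import Data.Nat.Properties as ℕ
open import Data.Product.Base using (_×_; ∃-syntax)
open import Level using (0ℓ)
open import Relation.Binary.PropositionalEquality
  using (_≡_; _≢_; _≗_; refl; trans; cong; cong₂)
open import Relation.Nullary using (does; ¬?; _×-dec_)
open import Relation.Unary using (Pred; Decidable)

private
  module ℤΣ = RawSemiringDefinitions ℤ.+-*-rawSemiring

-- ℤ⟦q⟧: a series is its sequence of coefficients.
PowerSeries : Set
PowerSeries = ℕ → ℤ

one : PowerSeries
one zero    = 1ℤ
one (suc _) = 0ℤ

rawRing : RawRing 0ℓ 0ℓ
rawRing = record
  { Carrier = PowerSeries
  ; _≈_     = _≗_
  ; _+_     = λ A B n → A n ℤ.+ B n
  ; _*_     = λ A B n → ℤΣ.sum {suc n} (λ i → A (toℕ i) ℤ.* B (n ∸ toℕ i))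
  ; -_      = λ A n → ℤ.- A n
  ; 0#      = λ _ → 0ℤ
  ; 1#      = one
  }

open RawRing rawRing public using (_≈_; _+_; _*_; -_; 0#; 1#)
open RawSemiringDefinitions (RawRing.rawSemiring rawRing) public
  using (_^_; sum; product)

infixl 6 _-_
_-_ : PowerSeries → PowerSeries → PowerSeries
A - B = A + (- B)

q : PowerSeries
q 1 = 1ℤ
q _ = 0ℤ

-- Long division, with remainder B A = (B - B₀ A) / q the series left after
-- one step. It is meaningful only for a divisor with constant
-- coefficient 1, where it is the quotient in ℤ⟦q⟧ by /-* below.
remainder : PowerSeries → PowerSeries → PowerSeries
remainder B A k = B (suc k) ℤ.- B zero ℤ.* A (suc k)

infixl 7 _/_
_/_ : PowerSeries → PowerSeries → PowerSeries
(B / A) zero    = B zero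
(B / A) (suc n) = (remainder B A / A) n

/-* : ∀ B A → A 0 ≡ 1ℤ → (B / A) * A ≈ B
/-* B A A₀≡1 zero =
  trans (ℤ.+-identityʳ _) (trans (cong (B 0 ℤ.*_) A₀≡1) (ℤ.*-identityʳ (B 0)))
/-* B A A₀≡1 (suc n) =
  trans (cong (λ x → B 0 ℤ.* A (suc n) ℤ.+ x) (/-* (remainder B A) A A₀≡1 n))
        (cancel (B 0 ℤ.* A (suc n)) (B (suc n)))
  where
  cancel : ∀ x y → x ℤ.+ (y ℤ.- x) ≡ y
  cancel = solve-∀

-- (a ; b)ₙ
⟨_⨾_⟩ : PowerSeries → PowerSeries → ℕ → PowerSeries
⟨ a ⨾ b ⟩ n = product {n} (λ j → 1# - a * b ^ toℕ j)

⟨⨾⟩-constant : ∀ a b n → a 0 ≡ 0ℤ → ⟨ a ⨾ b ⟩ n 0 ≡ 1ℤ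
⟨⨾⟩-constant a b n a₀≡0 = go n (λ j → b ^ j)
  where
  go : ∀ n (c : ℕ → PowerSeries) → product {n} (λ j → 1# - a * c (toℕ j)) 0 ≡ 1ℤ
  go zero    c = refl
  go (suc n) c =
    trans (ℤ.+-identityʳ _)
          (cong₂ ℤ._*_ (cong (λ x → 1ℤ ℤ.- (x ℤ.* c 0 0 ℤ.+ 0ℤ)) a₀≡0)
                       (go n (λ j → c (suc j))))

-- Convergence in the q-adic topology: every coefficient of F n is
-- eventually equal to that of L.
infix 4 _⟶_
_⟶_ : (ℕ → PowerSeries) → PowerSeries → Set
F ⟶ L = ∀ k → ∃[ N ] (∀ n → N ≤ n → F n k ≡ L k)

-- ∑_{n ≥ m} f n converges to S.
HasSumFrom : ℕ → (ℕ → PowerSeries) → PowerSeries → Set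
HasSumFrom m f S = (λ N → sum {N} (λ i → f (m ℕ.+ toℕ i))) ⟶ S

restrict : {P : Pred ℕ 0ℓ} → Decidable P → (ℕ → PowerSeries) → ℕ → PowerSeries
restrict P? f n = if does (P? n) then f n else 1#

-- ∏_{n ≥ m, P n} f n converges to L.
HasProductFrom : ℕ → {P : Pred ℕ 0ℓ} → Decidable P →
                 (ℕ → PowerSeries) → PowerSeries → Set
HasProductFrom m P? f L =
  (λ N → product {N} (λ i → restrict P? f (m ℕ.+ toℕ i))) ⟶ L

≢1,5,6[mod8] : Pred ℕ 0ℓ
≢1,5,6[mod8] n = n % 8 ≢ 1 × n % 8 ≢ 5 × n % 8 ≢ 6

≢1,5,6[mod8]? : Decidable ≢1,5,6[mod8]
≢1,5,6[mod8]? n =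
  ¬? (n % 8 ℕ.≟ 1) ×-dec ¬? (n % 8 ℕ.≟ 5) ×-dec ¬? (n % 8 ℕ.≟ 6)

-- Write C n = (-q³;q⁴)ₙ and D n = (q²;q²)ₙ. The series telescopes: its partial
-- sum through the n-th term is C n / D n, because
-- (1 - q²ⁿ) + q²ⁿ (1 + q²ⁿ⁻¹) = 1 + q⁴ⁿ⁻¹. On the product side, multiplying by
-- (q²;q²)_∞ (q³;q⁴)_∞ cancels all of its factors and leaves (q⁶;q⁸)_∞, which is also
-- (-q³;q⁴)_∞ (q³;q⁴)_∞. Both sides are compared in the rings ℤ⟦q⟧/(qᵏ⁺¹), where
-- the sum and all the products are finite.
module Submission where

open import Algebra.Bundles using (CommutativeMonoid; CommutativeRing)
import Algebra.Properties.AbelianGroup as AbelianGroupProperties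
import Algebra.Properties.CommutativeMonoid.Sum as CommutativeMonoidSum
import Algebra.Properties.CommutativeSemigroup as CommutativeSemigroupProperties
import Algebra.Properties.Ring as RingProperties
import Algebra.Properties.Semiring.Exp as SemiringExp
import Algebra.Properties.Semiring.Sum as SemiringSum
import Algebra.Solver.CommutativeMonoid as CommutativeMonoidSolver
open import Data.Bool.Base using (true; false; if_then_else_)
open import Data.Fin.Base using (toℕ)
import Data.Fin.Properties as Fin
open import Data.Integer.Base as ℤ using (0ℤ)
import Data.Integer.Properties as ℤ
open import Data.Nat.Base as ℕ using (ℕ; zero; suc; _≤_; _<_; z≤n; s≤s)
open import Data.Nat.DivMod using ([m+kn]%n≡m%n)
import Data.Nat.Properties as ℕ
open import Data.Nat.Tactic.RingSolver using (solve-∀)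
open import Data.Product.Base using (_,_)
open import Function.Base using (_∘_)
open import Level using (_⊔_; 0ℓ) renaming (suc to lsuc)
import Relation.Binary.PropositionalEquality as ≡
open import Relation.Binary.PropositionalEquality using (_≡_)
import Relation.Binary.Reasoning.Setoid as SetoidReasoning
open import Relation.Nullary using (does)
open import Defs using (≢1,5,6[mod8]?)

-- Finite sums and products over initial segments of ℕ.

module InitialFold {c ℓ} (M : CommutativeMonoid c ℓ) where
  open CommutativeMonoid M
  open CommutativeMonoidSum M using (sum; sum-cong-≋; ∑-distrib-+)

  fold : (ℕ → Carrier) → ℕ → Carrier
  fold f n = sum {n} (f ∘ toℕ)

  fold-cong : ∀ {f g} → (∀ i → f i ≈ g i) → ∀ n → fold f n ≈ fold g n
  fold-cong f≈g n = sum-cong-≋ {n} (f≈g ∘ toℕ)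

  fold-∙ : ∀ f g n → fold (λ i → f i ∙ g i) n ≈ fold f n ∙ fold g n
  fold-∙ f g n = ∑-distrib-+ {n} (f ∘ toℕ) (g ∘ toℕ)

  -- `fold` unfolds at index 0, whereas telescoping adds its terms at the top.
  fold-last : ∀ f n → fold f (suc n) ≈ fold f n ∙ f n
  fold-last f zero    = comm _ _
  fold-last f (suc n) =
    trans (∙-congˡ (fold-last (f ∘ suc) n)) (sym (assoc _ _ _))

  fold-+ : ∀ f m n → fold f (m ℕ.+ n) ≈ fold f m ∙ fold (λ i → f (m ℕ.+ i)) n
  fold-+ f zero    n = sym (identityˡ _)
  fold-+ f (suc m) n =
    trans (∙-congˡ (fold-+ (f ∘ suc) m n)) (sym (assoc _ _ _))

  -- For comparing products residue by residue modulo `m`. At a numeral `i` the index `i + j * m`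
  -- computes to successors of `j * m`, so the factors of a block can be read off by reduction.
  fold-blocks : ∀ m f k →
    fold f (k ℕ.* m) ≈ fold (λ j → fold (λ i → f (i ℕ.+ j ℕ.* m)) m) k
  fold-blocks m f zero    = refl
  fold-blocks m f (suc k) = trans (fold-+ f m (k ℕ.* m)) (∙-cong first rest)
    where
    open CommutativeSemigroupProperties ℕ.+-commutativeSemigroup
      using (x∙yz≈y∙xz)

    first : fold f m ≈ fold (λ i → f (i ℕ.+ 0)) m
    first = fold-cong (λ i → reflexive (≡.cong f (≡.sym (ℕ.+-identityʳ i)))) m

    rest : fold (λ i → f (m ℕ.+ i)) (k ℕ.* m) ≈
           fold (λ j → fold (λ i → f (i ℕ.+ suc j ℕ.* m)) m) k
    rest = trans (fold-blocks m (λ i → f (m ℕ.+ i)) k)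
      (fold-cong (λ j → fold-cong (λ i →
        reflexive (≡.cong f (x∙yz≈y∙xz m i (j ℕ.* m)))) m) k)

  -- The source of all convergence here: modulo qᵏ⁺¹ every term or factor from index `k` on is
  -- trivial.
  fold-stable : ∀ k {f} → (∀ n → k ≤ n → f n ≈ ε) →
                ∀ {n} → k ≤ n → fold f n ≈ fold f k
  fold-stable zero    f≈ε {zero}  z≤n = refl
  fold-stable zero    f≈ε {suc n} z≤n =
    trans (∙-cong (f≈ε 0 z≤n) (fold-stable zero (λ n _ → f≈ε (suc n) z≤n) {n} z≤n))
          (identityˡ ε)
  fold-stable (suc k) f≈ε (s≤s k≤n) =
    ∙-congˡ (fold-stable k (λ n k≤n → f≈ε (suc n) (s≤s k≤n)) k≤n)

-- Ring identities and cancellation.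

module RingLemmas {c ℓ} (R : CommutativeRing c ℓ) where
  open CommutativeRing R
  open RingProperties ring using (-‿distribˡ-*; -‿distribʳ-*; -‿involutive)
  open AbelianGroupProperties +-abelianGroup using (\\-leftDividesʳ)
  open SetoidReasoning setoid
  open InitialFold *-commutativeMonoid using () renaming (fold to ∏)

  x-y+[y+z]≈x+z : ∀ x y z → (x - y) + (y + z) ≈ x + z
  x-y+[y+z]≈x+z x y z = trans (+-assoc _ _ _) (+-congˡ (\\-leftDividesʳ y z))

  x*[1+y]≈x+x*y : ∀ x y → x * (1# + y) ≈ x + x * y
  x*[1+y]≈x+x*y x y = trans (distribˡ x 1# y) (+-congʳ (*-identityʳ x))

  [1+x]*[1-x]≈1-x*x : ∀ x → (1# + x) * (1# - x) ≈ 1# - x * x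
  [1+x]*[1-x]≈1-x*x x = begin
    (1# + x) * (1# - x)           ≈⟨ distribʳ _ 1# x ⟩
    1# * (1# - x) + x * (1# - x)  ≈⟨ +-cong (*-identityˡ _) (x*[1+y]≈x+x*y x (- x)) ⟩
    (1# - x) + (x + x * - x)      ≈⟨ x-y+[y+z]≈x+z 1# x _ ⟩
    1# + x * - x                  ≈⟨ +-congˡ (-‿distribʳ-* x x) ⟨
    1# - x * x                    ∎

  1--x*y≈1+x*y : ∀ x y → 1# - - x * y ≈ 1# + x * y
  1--x*y≈1+x*y x y =
    +-congˡ (trans (-‿cong (sym (-‿distribˡ-* x y))) (-‿involutive _))

  x≈0⇒1-x≈1 : ∀ {x} → x ≈ 0# → 1# - x ≈ 1#
  x≈0⇒1-x≈1 {x} x≈0 = begin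
    1# - x           ≈⟨ +-congˡ (+-identityʳ _) ⟨
    1# + (- x + 0#)  ≈⟨ +-congˡ (+-congˡ x≈0) ⟨
    1# + (- x + x)   ≈⟨ +-congˡ (-‿inverseˡ x) ⟩
    1# + 0#          ≈⟨ +-identityʳ 1# ⟩
    1#               ∎

  -- Cancellation stands in for division: the two sides are compared after multiplication by
  -- denominators, which are then removed.
  Cancellable : Carrier → Set _
  Cancellable x = ∀ {y z} → y * x ≈ z * x → y ≈ z

  invertible⇒cancellable : ∀ {x x⁻¹} → x⁻¹ * x ≈ 1# → Cancellable x
  invertible⇒cancellable {x} {x⁻¹} x⁻¹x≈1 {y} {z} yx≈zx = begin
    y              ≈⟨ undo y ⟨
    y * x * x⁻¹    ≈⟨ *-congʳ yx≈zx ⟩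
    z * x * x⁻¹    ≈⟨ undo z ⟩
    z              ∎
    where
    undo : ∀ w → w * x * x⁻¹ ≈ w
    undo w = trans (*-assoc w x x⁻¹)
      (trans (*-congˡ (trans (*-comm x x⁻¹) x⁻¹x≈1)) (*-identityʳ w))

  *-cancellable : ∀ {x y} → Cancellable x → Cancellable y → Cancellable (x * y)
  *-cancellable cx cy {u} {v} eq =
    cx (cy (trans (*-assoc u _ _) (trans eq (sym (*-assoc v _ _)))))

  ∏-cancellable : ∀ {f} → (∀ i → Cancellable (f i)) → ∀ n → Cancellable (∏ f n)
  ∏-cancellable cf zero    eq =
    trans (sym (*-identityʳ _)) (trans eq (*-identityʳ _))
  ∏-cancellable {f} cf (suc n) =
    *-cancellable {f 0} (cf 0) (∏-cancellable (cf ∘ suc) n)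

-- An axiomatic view of power series modulo qᵏ⁺¹.

record TruncatedSeriesRing c ℓ : Set (lsuc (c ⊔ ℓ)) where
  infixr 8 _^_
  field
    ring : CommutativeRing c ℓ

  open CommutativeRing ring hiding (ring) public

  field
    -- Not the library's power function: that one depends on the equality of its
    -- ring, so the powers in ℤ⟦q⟧ and in its truncations would not unify.
    _^_    : Carrier → ℕ → Carrier
    ^-zero : ∀ x → x ^ 0 ≈ 1#
    ^-suc  : ∀ x n → x ^ suc n ≈ x * x ^ n

    q           : Carrier
    inv         : ℕ → Carrier
    -- Exponents start at 1, since 1 - q⁰ is zero.
    inv-inverse : ∀ n → inv (suc n) * (1# - q ^ suc n) ≈ 1#

    k     : ℕ
    q^n≈0 : ∀ {n} → k < n → q ^ n ≈ 0#

  private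
    module Exp = SemiringExp semiring

    ^≈ : ∀ x n → x ^ n ≈ x Exp.^ n
    ^≈ x zero    = ^-zero x
    ^≈ x (suc n) = trans (^-suc x n) (*-congˡ (^≈ x n))

  open SetoidReasoning setoid

  ^-congʳ : ∀ x {m n} → m ≡ n → x ^ m ≈ x ^ n
  ^-congʳ x m≡n = reflexive (≡.cong (x ^_) m≡n)

  ^-homo-* : ∀ x m n → x ^ (m ℕ.+ n) ≈ x ^ m * x ^ n
  ^-homo-* x m n = begin
    x ^ (m ℕ.+ n)          ≈⟨ ^≈ x (m ℕ.+ n) ⟩
    x Exp.^ (m ℕ.+ n)      ≈⟨ Exp.^-homo-* x m n ⟩
    x Exp.^ m * x Exp.^ n  ≈⟨ *-cong (^≈ x m) (^≈ x n) ⟨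
    x ^ m * x ^ n          ∎

  ^-assocʳ : ∀ x m n → (x ^ m) ^ n ≈ x ^ (m ℕ.* n)
  ^-assocʳ x m n = begin
    (x ^ m) ^ n          ≈⟨ ^≈ (x ^ m) n ⟩
    (x ^ m) Exp.^ n      ≈⟨ Exp.^-congˡ n (^≈ x m) ⟩
    (x Exp.^ m) Exp.^ n  ≈⟨ Exp.^-assocʳ x m n ⟩
    x Exp.^ (m ℕ.* n)    ≈⟨ ^≈ x (m ℕ.* n) ⟨
    x ^ (m ℕ.* n)        ∎

-- The identity modulo qᵏ⁺¹.

module Identity {a ℓ} (T : TruncatedSeriesRing a ℓ) where
  open TruncatedSeriesRing T
  open RingLemmas ring
  open SetoidReasoning setoid
  open InitialFold +-commutativeMonoid using ()
    renaming (fold to ∑; fold-last to ∑-last; fold-stable to ∑-stable)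
  open InitialFold *-commutativeMonoid using ()
    renaming ( fold to ∏; fold-cong to ∏-cong; fold-∙ to ∏-*; fold-last to ∏-last
             ; fold-blocks to ∏-blocks; fold-stable to ∏-stable)

  -- `c` and `d` have literally the shape of the factors of `⟨_⨾_⟩`, so `C` and `D` agree by
  -- definition with the products in the statement. `d′`, `e` and `h` carry a single exponent
  -- beginning with a numeral, the form that `inv-inverse` and the block computation match.
  c d d′ e h C D E H : ℕ → Carrier
  c j  = 1# - - (q ^ 3) * (q ^ 4) ^ j
  d j  = 1# - q ^ 2 * (q ^ 2) ^ j
  d′ j = 1# - q ^ (2 ℕ.+ j ℕ.* 2)
  e j  = 1# - q ^ (3 ℕ.+ j ℕ.* 4)
  h j  = 1# - q ^ (6 ℕ.+ j ℕ.* 8)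
  C = ∏ c
  D = ∏ d
  E = ∏ e
  H = ∏ h

  factor : ℕ → Carrier
  factor n = if does (≢1,5,6[mod8]? n) then inv n else 1#

  P : ℕ → Carrier
  P = ∏ (factor ∘ suc)

  progression : ∀ a m j → q ^ a * (q ^ m) ^ j ≈ q ^ (a ℕ.+ j ℕ.* m)
  progression a m j = begin
    q ^ a * (q ^ m) ^ j    ≈⟨ *-congˡ (^-assocʳ q m j) ⟩
    q ^ a * q ^ (m ℕ.* j)  ≈⟨ *-congˡ (^-congʳ q (ℕ.*-comm m j)) ⟩
    q ^ a * q ^ (j ℕ.* m)  ≈⟨ ^-homo-* q a (j ℕ.* m) ⟨
    q ^ (a ℕ.+ j ℕ.* m)    ∎

  c≈ : ∀ j → c j ≈ 1# + q ^ (3 ℕ.+ j ℕ.* 4)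
  c≈ j = trans (1--x*y≈1+x*y _ _) (+-congˡ (progression 3 4 j))

  d≈d′ : ∀ j → d j ≈ d′ j
  d≈d′ j = +-congˡ (-‿cong (progression 2 2 j))

  D≈ : ∀ n → D n ≈ ∏ d′ n
  D≈ = ∏-cong d≈d′

  D-cancellable : ∀ n → Cancellable (D n)
  D-cancellable n eq =
    -- `inv-inverse` is indexed by the predecessor of the exponent 2 + 2j.
    ∏-cancellable (λ j → invertible⇒cancellable (inv-inverse (1 ℕ.+ j ℕ.* 2))) n
      (trans (*-congˡ (sym (D≈ n))) (trans eq (*-congˡ (D≈ n))))

  E-cancellable : ∀ n → Cancellable (E n)
  E-cancellable =
    ∏-cancellable (λ j → invertible⇒cancellable (inv-inverse (2 ℕ.+ j ℕ.* 4)))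

  -- The leading `suc` makes the bound on the exponent strict.
  q^[1+a+j*m]≈0 : ∀ a m .{{_ : ℕ.NonZero m}} {j} → k ≤ j →
                  q ^ (suc a ℕ.+ j ℕ.* m) ≈ 0#
  q^[1+a+j*m]≈0 a m {j} k≤j = q^n≈0 (s≤s
    (ℕ.≤-trans k≤j (ℕ.≤-trans (ℕ.m≤m*n j m) (ℕ.m≤n+m (j ℕ.* m) a))))

  C-stable : ∀ {n} → k ≤ n → C n ≈ C k
  C-stable = ∏-stable k (λ j k≤j → trans (c≈ j)
    (trans (+-congˡ (q^[1+a+j*m]≈0 2 4 k≤j)) (+-identityʳ 1#)))

  D-stable : ∀ {n} → k ≤ n → D n ≈ D k
  D-stable = ∏-stable k (λ j k≤j →
    trans (d≈d′ j) (x≈0⇒1-x≈1 (q^[1+a+j*m]≈0 1 2 k≤j)))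

  E-stable : ∀ {n} → k ≤ n → E n ≈ E k
  E-stable = ∏-stable k (λ j k≤j → x≈0⇒1-x≈1 (q^[1+a+j*m]≈0 2 4 k≤j))

  P-stable : ∀ {n} → k ≤ n → P n ≈ P k
  P-stable = ∏-stable k factor≈1
    where
    factor≈1 : ∀ n → k ≤ n → factor (suc n) ≈ 1#
    factor≈1 n k≤n with does (≢1,5,6[mod8]? (suc n))
    ... | false = refl
    -- The denominator is already 1 modulo qᵏ⁺¹, hence so is its inverse.
    ... | true  = begin
      inv (suc n)                      ≈⟨ *-identityʳ _ ⟨
      inv (suc n) * 1#                 ≈⟨ *-congˡ (x≈0⇒1-x≈1 (q^n≈0 (s≤s k≤n))) ⟨
      inv (suc n) * (1# - q ^ suc n)   ≈⟨ inv-inverse n ⟩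
      1#                               ∎

  -- Factor by factor this is (1 + x)(1 - x) = 1 - x² with x = q³⁺⁴ʲ.
  C*E≈H : ∀ n → C n * E n ≈ H n
  C*E≈H n = trans (sym (∏-* c e n)) (∏-cong pair n)
    where
    double : ∀ j → 3 ℕ.+ j ℕ.* 4 ℕ.+ (3 ℕ.+ j ℕ.* 4) ≡ 6 ℕ.+ j ℕ.* 8
    double = solve-∀

    pair : ∀ j → c j * e j ≈ h j
    pair j = begin
      c j * (1# - x)       ≈⟨ *-congʳ (c≈ j) ⟩
      (1# + x) * (1# - x)  ≈⟨ [1+x]*[1-x]≈1-x*x x ⟩
      1# - x * x
        ≈⟨ +-congˡ (-‿cong (^-homo-* q (3 ℕ.+ j ℕ.* 4) (3 ℕ.+ j ℕ.* 4))) ⟨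
      1# - q ^ (3 ℕ.+ j ℕ.* 4 ℕ.+ (3 ℕ.+ j ℕ.* 4))
        ≈⟨ +-congˡ (-‿cong (^-congʳ q (double j))) ⟩
      h j                  ∎
      where x = q ^ (3 ℕ.+ j ℕ.* 4)

  -- Eight consecutive factors of P meet four of D and two of E; only the
  -- factor of D with exponent 6 modulo 8 survives.
  P*D*E≈H : ∀ n → P (n ℕ.* 8) * D (n ℕ.* 4) * E (n ℕ.* 2) ≈ H n
  P*D*E≈H n = begin
    P (n ℕ.* 8) * D (n ℕ.* 4) * E (n ℕ.* 2)
      ≈⟨ *-cong (*-cong (∏-blocks 8 (factor ∘ suc) n)
                        (trans (D≈ (n ℕ.* 4)) (∏-blocks 4 d′ n)))
                (∏-blocks 2 e n) ⟩
    ∏ P-block n * ∏ D-block n * ∏ E-block n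
      ≈⟨ *-congʳ (∏-* P-block D-block n) ⟨
    ∏ (λ j → P-block j * D-block j) n * ∏ E-block n
      ≈⟨ ∏-* (λ j → P-block j * D-block j) E-block n ⟨
    ∏ (λ j → P-block j * D-block j * E-block j) n
      ≈⟨ ∏-cong block n ⟩
    H n ∎
    where
    P-block D-block E-block : ℕ → Carrier
    P-block j = ∏ (λ i → factor (suc (i ℕ.+ j ℕ.* 8))) 8
    D-block j = ∏ (λ i → d′ (i ℕ.+ j ℕ.* 4)) 4
    E-block j = ∏ (λ i → e (i ℕ.+ j ℕ.* 2)) 2

    -- The decision inspects its argument only through `% 8`, so rewriting the residue suffices.
    factor-periodic : ∀ a j → factor (a ℕ.+ j ℕ.* 8) ≈
      (if does (≢1,5,6[mod8]? a) then inv (a ℕ.+ j ℕ.* 8) else 1#)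
    factor-periodic a j rewrite [m+kn]%n≡m%n a j 8 {{_}} = refl

    -- At numerals the conditional computes: residues 1, 5 and 6 give `1#`, and 8 represents residue
    -- 0.
    P-block≈ : ∀ j → let b = j ℕ.* 8 in P-block j ≈
      1# * (inv (2 ℕ.+ b) * (inv (3 ℕ.+ b) * (inv (4 ℕ.+ b) *
        (1# * (1# * (inv (7 ℕ.+ b) * (inv (8 ℕ.+ b) * 1#)))))))
    P-block≈ j =
      *-cong (factor-periodic 1 j) (*-cong (factor-periodic 2 j)
      (*-cong (factor-periodic 3 j) (*-cong (factor-periodic 4 j)
      (*-cong (factor-periodic 5 j) (*-cong (factor-periodic 6 j)
      (*-cong (factor-periodic 7 j) (*-cong (factor-periodic 8 j) refl)))))))

    φ : ℕ → Carrier
    φ n = 1# - q ^ n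

    -- For a numeral `i` the exponent computes to 2 + 2i + (j * 4) * 2, so one reassociation exposes
    -- the common base 8j. The same works for `E-block` with (j * 2) * 4.
    D-block≈ : ∀ j → let b = j ℕ.* 8 in D-block j ≈
      φ (2 ℕ.+ b) * (φ (4 ℕ.+ b) * (φ (6 ℕ.+ b) * (φ (8 ℕ.+ b) * 1#)))
    D-block≈ j rewrite ℕ.*-assoc j 4 2 = refl

    E-block≈ : ∀ j → let b = j ℕ.* 8 in E-block j ≈
      φ (3 ℕ.+ b) * (φ (7 ℕ.+ b) * 1#)
    E-block≈ j rewrite ℕ.*-assoc j 2 4 = refl

    open CommutativeMonoidSolver *-commutativeMonoid

    -- Each inverse meets its own factor, with the unpaired exponent 6 innermost, so that `absorb`
    -- always acts at the head.
    regroup : ∀ i₂ i₃ i₄ i₇ i₈ f₂ f₃ f₄ f₆ f₇ f₈ →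
      1# * (i₂ * (i₃ * (i₄ * (1# * (1# * (i₇ * (i₈ * 1#))))))) *
      (f₂ * (f₄ * (f₆ * (f₈ * 1#)))) * (f₃ * (f₇ * 1#)) ≈
      i₂ * f₂ * (i₃ * f₃ * (i₄ * f₄ * (i₇ * f₇ * (i₈ * f₈ * f₆))))
    regroup = solve 11 (λ i₂ i₃ i₄ i₇ i₈ f₂ f₃ f₄ f₆ f₇ f₈ →
      ((id ⊕ (i₂ ⊕ (i₃ ⊕ (i₄ ⊕ (id ⊕ (id ⊕ (i₇ ⊕ (i₈ ⊕ id)))))))) ⊕
       (f₂ ⊕ (f₄ ⊕ (f₆ ⊕ (f₈ ⊕ id))))) ⊕ (f₃ ⊕ (f₇ ⊕ id)) ⊜
      (i₂ ⊕ f₂) ⊕ ((i₃ ⊕ f₃) ⊕ ((i₄ ⊕ f₄) ⊕ ((i₇ ⊕ f₇) ⊕ ((i₈ ⊕ f₈) ⊕ f₆))))) refl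

    absorb : ∀ n x → inv (suc n) * φ (suc n) * x ≈ x
    absorb n x = trans (*-congʳ (inv-inverse n)) (*-identityˡ x)

    block : ∀ j → P-block j * D-block j * E-block j ≈ φ (6 ℕ.+ j ℕ.* 8)
    block j = let b = j ℕ.* 8 in begin
      P-block j * D-block j * E-block j
        ≈⟨ *-cong (*-cong (P-block≈ j) (D-block≈ j)) (E-block≈ j) ⟩
      _ ≈⟨ regroup _ _ _ _ _ _ _ _ _ _ _ ⟩
      _ ≈⟨ absorb (1 ℕ.+ b) _ ⟩
      _ ≈⟨ absorb (2 ℕ.+ b) _ ⟩
      _ ≈⟨ absorb (3 ℕ.+ b) _ ⟩
      _ ≈⟨ absorb (6 ℕ.+ b) _ ⟩
      _ ≈⟨ absorb (7 ℕ.+ b) _ ⟩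
      φ (6 ℕ.+ b) ∎

  -- One telescoping step with denominators cleared; `x` plays the role of C n / D n. The new factor
  -- of `D` is 1 - y, and (1 - y) + y(1 + z) = 1 + yz, where yz = q³⁺⁴ⁿ gives exactly the new factor
  -- of `C`.
  telescope : ∀ n {x t} → x * D n ≈ C n →
    t * D (suc n) ≈ C n * q ^ (2 ℕ.* suc n) * (1# + q ^ (2 ℕ.* suc n ℕ.∸ 1)) →
    (x + t) * D (suc n) ≈ C (suc n)
  telescope n {x} {t} xD≈C tD≈ = begin
    (x + t) * D (suc n)                          ≈⟨ distribʳ _ x t ⟩
    x * D (suc n) + t * D (suc n)                ≈⟨ +-cong left right ⟩
    C n * (1# - y) + C n * (y * (1# + z))        ≈⟨ distribˡ _ _ _ ⟨
    C n * ((1# - y) + y * (1# + z))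
      ≈⟨ *-congˡ (+-congˡ (x*[1+y]≈x+x*y y z)) ⟩
    C n * ((1# - y) + (y + y * z))               ≈⟨ *-congˡ (x-y+[y+z]≈x+z 1# y _) ⟩
    C n * (1# + y * z)                           ≈⟨ *-congˡ (+-congˡ yz≈) ⟩
    C n * (1# + q ^ (3 ℕ.+ n ℕ.* 4))             ≈⟨ *-congˡ (c≈ n) ⟨
    C n * c n                                    ≈⟨ ∏-last c n ⟨
    C (suc n)                                    ∎
    where
    y = q ^ (2 ℕ.* suc n)
    z = q ^ (2 ℕ.* suc n ℕ.∸ 1)

    even : ∀ n → 2 ℕ.+ n ℕ.* 2 ≡ 2 ℕ.* suc n
    even = solve-∀

    -- The second summand is what `2 * suc n ∸ 1` computes to.
    odd : ∀ n → 2 ℕ.* suc n ℕ.+ (n ℕ.+ suc (n ℕ.+ 0)) ≡ 3 ℕ.+ n ℕ.* 4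
    odd = solve-∀

    yz≈ : y * z ≈ q ^ (3 ℕ.+ n ℕ.* 4)
    yz≈ = trans (sym (^-homo-* q (2 ℕ.* suc n) _)) (^-congʳ q (odd n))

    left : x * D (suc n) ≈ C n * (1# - y)
    left = begin
      x * D (suc n)    ≈⟨ *-congˡ (∏-last d n) ⟩
      x * (D n * d n)  ≈⟨ *-assoc x _ _ ⟨
      x * D n * d n
        ≈⟨ *-cong xD≈C (trans (d≈d′ n) (+-congˡ (-‿cong (^-congʳ q (even n))))) ⟩
      C n * (1# - y)   ∎

    right : t * D (suc n) ≈ C n * (y * (1# + z))
    right = trans tD≈ (*-assoc (C n) y _)

  -- The quotients enter only through their products with the denominators, so the argument does not
  -- depend on how long division is computed.
  module Series
    (r : Carrier) (r-quotient : r * (1# - q ^ 2) ≈ q ^ 2 + q ^ 3)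
    (t : ℕ → Carrier)
    (t-quotient : ∀ n → t (suc n) * D (suc n) ≈
      C n * q ^ (2 ℕ.* suc n) * (1# + q ^ (2 ℕ.* suc n ℕ.∸ 1)))
    where

    partialSum : ℕ → Carrier
    partialSum = ∑ (λ i → t (2 ℕ.+ i))

    partialSum-stable : ∀ {n} → k ≤ n → partialSum n ≈ partialSum k
    partialSum-stable = ∑-stable k {λ i → t (2 ℕ.+ i)} t≈0
      where
      k<2n : ∀ {n} → k ≤ n → k < 2 ℕ.* (2 ℕ.+ n)
      k<2n {n} k≤n =
        s≤s (ℕ.≤-trans k≤n (ℕ.≤-trans (ℕ.n≤1+n n) (ℕ.m≤m+n (suc n) _)))

      t≈0 : ∀ n → k ≤ n → t (2 ℕ.+ n) ≈ 0#
      -- Cancelling `D` leaves the numerator, which contains a power of q that vanishes modulo qᵏ⁺¹.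
      t≈0 n k≤n = D-cancellable (2 ℕ.+ n) (begin
        t (2 ℕ.+ n) * D (2 ℕ.+ n)                         ≈⟨ t-quotient (suc n) ⟩
        C (suc n) * q ^ (2 ℕ.* (2 ℕ.+ n)) * (1# + _)
          ≈⟨ *-congʳ (*-congˡ (q^n≈0 (k<2n k≤n))) ⟩
        C (suc n) * 0# * (1# + _)                         ≈⟨ *-congʳ (zeroʳ _) ⟩
        0# * (1# + _)                                     ≈⟨ zeroˡ _ ⟩
        0#                                                ≈⟨ zeroˡ _ ⟨
        0# * D (2 ℕ.+ n)                                  ∎)

    -- The isolated fraction `r` is the n = 1 term of the series, because q² + q³ = q²(1 + q).
    -- Induction therefore starts from 1 = C 0 / D 0, and `partialSum n` ends with the term of index
    -- n + 1.
    partialSum*D≈C : ∀ n → (1# + r + partialSum n) * D (suc n) ≈ C (suc n)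
    partialSum*D≈C zero    = trans (*-congʳ (+-identityʳ _))
      (telescope 0 (*-identityˡ 1#) (begin
        r * ((1# - q ^ 2 * (q ^ 2) ^ 0) * 1#)
          ≈⟨ *-congˡ (trans (*-identityʳ _) (+-congˡ (-‿cong
             (trans (*-congˡ (^-zero (q ^ 2))) (*-identityʳ _))))) ⟩
        r * (1# - q ^ 2)            ≈⟨ r-quotient ⟩
        q ^ 2 + q ^ 3               ≈⟨ +-congˡ (^-homo-* q 2 1) ⟩
        q ^ 2 + q ^ 2 * q ^ 1       ≈⟨ x*[1+y]≈x+x*y _ _ ⟨
        q ^ 2 * (1# + q ^ 1)        ≈⟨ *-congʳ (*-identityˡ _) ⟨
        1# * q ^ 2 * (1# + q ^ 1)   ∎))
    partialSum*D≈C (suc n) = trans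
      (*-congʳ (trans (+-congˡ (∑-last (λ i → t (2 ℕ.+ i)) n))
                      (sym (+-assoc _ _ _))))
      (telescope (suc n) (partialSum*D≈C n) (t-quotient (suc n)))

    -- Multiplied by `D` and `E`, both sides become `H k`. The lengths k + 1 from telescoping and
    -- 8k, 4k, 2k from the blocks all reduce to k by stability.
    partialSum≈P : 1# + r + partialSum k ≈ P k
    partialSum≈P = D-cancellable k (E-cancellable k (begin
      (1# + r + partialSum k) * D k * E k
        ≈⟨ *-congʳ (*-congˡ (D-stable (ℕ.n≤1+n k))) ⟨
      (1# + r + partialSum k) * D (suc k) * E k
        ≈⟨ *-congʳ (partialSum*D≈C k) ⟩
      C (suc k) * E k       ≈⟨ *-congʳ (C-stable (ℕ.n≤1+n k)) ⟩
      C k * E k             ≈⟨ C*E≈H k ⟩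
      H k                   ≈⟨ P*D*E≈H k ⟨
      P (k ℕ.* 8) * D (k ℕ.* 4) * E (k ℕ.* 2)
        ≈⟨ *-cong (*-cong (P-stable (ℕ.m≤m*n k 8)) (D-stable (ℕ.m≤m*n k 4)))
                  (E-stable (ℕ.m≤m*n k 2)) ⟩
      P k * D k * E k       ∎))

open import Defs
open import Data.Nat.Base using (_∸_) renaming (_*_ to _*ℕ_)
open import Data.Product.Base using (_×_; ∃-syntax)

-- The ring of power series and its truncations.

module TruncatedRing where
  open CommutativeMonoidSum ℤ.+-0-commutativeMonoid
    using (sum-cong-≗; sum-replicate-zero; ∑-distrib-+)
  open SemiringSum ℤ.+-*-semiring using (*-distribˡ-sum)
  open CommutativeSemigroupProperties ℤ.+-commutativeSemigroup using (x∙yz≈y∙xz)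
  open ≡.≡-Reasoning

  infix 4 _≈[_]_
  _≈[_]_ : PowerSeries → ℕ → PowerSeries → Set
  A ≈[ k ] B = ∀ i → i ≤ k → A i ≡ B i

  -- A coefficient of a product involves only coefficients of equal or lower index; hence truncated
  -- equality is a congruence.
  *-cong-≤ : ∀ {A A′ B B′} k → A ≈[ k ] A′ → B ≈[ k ] B′ →
             (A * B) k ≡ (A′ * B′) k
  *-cong-≤ k A≈A′ B≈B′ = sum-cong-≗ {suc k} (λ i → ≡.cong₂ ℤ._*_
    (A≈A′ (toℕ i) (Fin.toℕ≤pred[n] i)) (B≈B′ (k ∸ toℕ i) (ℕ.m∸n≤m k (toℕ i))))

  *-zeroˡ : ∀ A → (λ _ → 0ℤ) * A ≈ 0#
  *-zeroˡ A n = sum-replicate-zero (suc n)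

  *-identityˡ : ∀ A → 1# * A ≈ A
  *-identityˡ A zero    = ≡.trans (ℤ.+-identityʳ _) (ℤ.*-identityˡ (A 0))
  *-identityˡ A (suc n) =
    ≡.trans (≡.cong₂ ℤ._+_ (ℤ.*-identityˡ (A (suc n))) (*-zeroˡ A n))
            (ℤ.+-identityʳ _)

  *-distribʳ-+ : ∀ A B C → (B + C) * A ≈ B * A + C * A
  *-distribʳ-+ A B C n = ≡.trans
    (sum-cong-≗ {suc n} (λ i → ℤ.*-distribʳ-+ (A (n ∸ toℕ i)) (B (toℕ i)) (C (toℕ i))))
    (∑-distrib-+ {suc n} (λ i → B (toℕ i) ℤ.* A (n ∸ toℕ i))
                         (λ i → C (toℕ i) ℤ.* A (n ∸ toℕ i)))

  scale-* : ∀ c A B n → ((λ m → c ℤ.* A m) * B) n ≡ c ℤ.* (A * B) n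
  scale-* c A B n = ≡.trans
    (sum-cong-≗ {suc n} (λ i → ℤ.*-assoc c (A (toℕ i)) (B (n ∸ toℕ i))))
    (≡.sym (*-distribˡ-sum {suc n} c (λ i → A (toℕ i) ℤ.* B (n ∸ toℕ i))))

  -- Induction on the coefficient index. With A = A₀ + qA′, where A′ is `A ∘ suc`, a product unfolds
  -- by definition as AB = A₀B + q(A′B), and the induction hypothesis applies to A′.
  *-assoc : ∀ A B C → (A * B) * C ≈ A * (B * C)
  *-assoc A B C zero = begin
    (A 0 ℤ.* B 0 ℤ.+ 0ℤ) ℤ.* C 0 ℤ.+ 0ℤ
      ≡⟨ ≡.cong (λ x → x ℤ.* C 0 ℤ.+ 0ℤ) (ℤ.+-identityʳ (A 0 ℤ.* B 0)) ⟩
    A 0 ℤ.* B 0 ℤ.* C 0 ℤ.+ 0ℤ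
      ≡⟨ ≡.cong (ℤ._+ 0ℤ) (ℤ.*-assoc (A 0) (B 0) (C 0)) ⟩
    A 0 ℤ.* (B 0 ℤ.* C 0) ℤ.+ 0ℤ
      ≡⟨ ≡.cong (λ x → A 0 ℤ.* x ℤ.+ 0ℤ) (ℤ.+-identityʳ (B 0 ℤ.* C 0)) ⟨
    A 0 ℤ.* (B 0 ℤ.* C 0 ℤ.+ 0ℤ) ℤ.+ 0ℤ ∎
  *-assoc A B C (suc n) = begin
    (A 0 ℤ.* B 0 ℤ.+ 0ℤ) ℤ.* C (suc n) ℤ.+ (((A * B) ∘ suc) * C) n
      ≡⟨ ≡.cong₂ ℤ._+_ (≡.cong (ℤ._* C (suc n)) (ℤ.+-identityʳ (A 0 ℤ.* B 0)))
           (*-distribʳ-+ C (λ m → A 0 ℤ.* B (suc m)) ((A ∘ suc) * B) n) ⟩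
    A 0 ℤ.* B 0 ℤ.* C (suc n) ℤ.+
      (((λ m → A 0 ℤ.* B (suc m)) * C) n ℤ.+ (((A ∘ suc) * B) * C) n)
      ≡⟨ ≡.cong₂ ℤ._+_ (ℤ.*-assoc (A 0) (B 0) _)
           (≡.cong₂ ℤ._+_ (scale-* (A 0) (B ∘ suc) C n) (*-assoc (A ∘ suc) B C n)) ⟩
    A 0 ℤ.* (B 0 ℤ.* C (suc n)) ℤ.+
      (A 0 ℤ.* ((B ∘ suc) * C) n ℤ.+ ((A ∘ suc) * (B * C)) n)
      ≡⟨ ℤ.+-assoc (A 0 ℤ.* (B 0 ℤ.* C (suc n))) _ _ ⟨
    A 0 ℤ.* (B 0 ℤ.* C (suc n)) ℤ.+ A 0 ℤ.* ((B ∘ suc) * C) n ℤ.+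
      ((A ∘ suc) * (B * C)) n
      ≡⟨ ≡.cong (ℤ._+ ((A ∘ suc) * (B * C)) n)
           (ℤ.*-distribˡ-+ (A 0) (B 0 ℤ.* C (suc n)) _) ⟨
    (A * (B * C)) (suc n) ∎

  -- The mirror image of the definitional unfolding of A * B at suc n.
  *-sucʳ : ∀ A B n → (A * B) (suc n) ≡ A (suc n) ℤ.* B 0 ℤ.+ (A * (B ∘ suc)) n
  *-sucʳ A B zero    = x∙yz≈y∙xz (A 0 ℤ.* B 1) (A 1 ℤ.* B 0) 0ℤ
  *-sucʳ A B (suc n) = ≡.trans
    (≡.cong (λ x → A 0 ℤ.* B (suc (suc n)) ℤ.+ x) (*-sucʳ (A ∘ suc) B n))
    (x∙yz≈y∙xz (A 0 ℤ.* B (suc (suc n))) (A (suc (suc n)) ℤ.* B 0) _)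

  -- The left product is split at the head of `A` by definition, the right one by `*-sucʳ`; the
  -- remainders agree by induction.
  *-comm : ∀ A B → A * B ≈ B * A
  *-comm A B zero    = ≡.cong (ℤ._+ 0ℤ) (ℤ.*-comm (A 0) (B 0))
  *-comm A B (suc n) = ≡.trans
    (≡.cong₂ ℤ._+_ (ℤ.*-comm (A 0) (B (suc n))) (*-comm (A ∘ suc) B n))
    (≡.sym (*-sucʳ B A n))

  *-identityʳ : ∀ A → A * 1# ≈ A
  *-identityʳ A n = ≡.trans (*-comm A 1# n) (*-identityˡ A n)

  *-distribˡ-+ : ∀ A B C → A * (B + C) ≈ A * B + A * C
  *-distribˡ-+ A B C n = ≡.trans (*-comm A (B + C) n) (≡.trans (*-distribʳ-+ A B C n)
    (≡.cong₂ ℤ._+_ (*-comm B A n) (*-comm C A n)))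

  -- ℤ⟦q⟧/(qᵏ⁺¹), presented as ℤ⟦q⟧ with a coarser equality.
  truncated : ℕ → CommutativeRing 0ℓ 0ℓ
  truncated k = record
    { Carrier = PowerSeries
    ; _≈_     = _≈[ k ]_
    ; _+_     = _+_
    ; _*_     = _*_
    ; -_      = -_
    ; 0#      = 0#
    ; 1#      = 1#
    ; isCommutativeRing = record
      { isRing = record
        { +-isAbelianGroup = record
          { isGroup = record
            { isMonoid = record
              { isSemigroup = record
                { isMagma = record
                  { isEquivalence = record
                    { refl  = λ _ _ → ≡.refl
                    ; sym   = λ A≈B i i≤k → ≡.sym (A≈B i i≤k)
                    ; trans = λ A≈B B≈C i i≤k → ≡.trans (A≈B i i≤k) (B≈C i i≤k)
                    }
                  ; ∙-cong = λ A≈A′ B≈B′ i i≤k →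
                      ≡.cong₂ ℤ._+_ (A≈A′ i i≤k) (B≈B′ i i≤k)
                  }
                ; assoc = λ A B C i _ → ℤ.+-assoc (A i) (B i) (C i)
                }
              ; identity = (λ A i _ → ℤ.+-identityˡ (A i))
                         , (λ A i _ → ℤ.+-identityʳ (A i))
              }
            ; inverse = (λ A i _ → ℤ.+-inverseˡ (A i))
                      , (λ A i _ → ℤ.+-inverseʳ (A i))
            ; ⁻¹-cong = λ A≈B i i≤k → ≡.cong ℤ.-_ (A≈B i i≤k)
            }
          ; comm = λ A B i _ → ℤ.+-comm (A i) (B i)
          }
        ; *-cong = λ {A} {A′} {B} {B′} A≈A′ B≈B′ i i≤k →
            *-cong-≤ {A} {A′} {B} {B′} i
            (λ j j≤i → A≈A′ j (ℕ.≤-trans j≤i i≤k))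
            (λ j j≤i → B≈B′ j (ℕ.≤-trans j≤i i≤k))
        ; *-assoc    = λ A B C i _ → *-assoc A B C i
        ; *-identity = (λ A i _ → *-identityˡ A i) , (λ A i _ → *-identityʳ A i)
        ; distrib    = (λ A B C i _ → *-distribˡ-+ A B C i)
                     , (λ A B C i _ → *-distribʳ-+ A B C i)
        }
      ; *-comm = λ A B i _ → *-comm A B i
      }
    }

  q∘suc≈1 : q ∘ suc ≈ 1#
  q∘suc≈1 zero    = ≡.refl
  q∘suc≈1 (suc n) = ≡.refl

  -- Multiplication by q shifts coefficients by one: q has constant term 0 and `q ∘ suc` is 1.
  q^n-below : ∀ n i → i < n → (q ^ n) i ≡ 0ℤ
  q^n-below (suc n) zero    _         = ≡.refl
  q^n-below (suc n) (suc i) (s≤s i<n) = begin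
    0ℤ ℤ.+ ((q ∘ suc) * q ^ n) i  ≡⟨ ℤ.+-identityˡ _ ⟩
    ((q ∘ suc) * q ^ n) i
      ≡⟨ *-cong-≤ {q ∘ suc} {1#} {q ^ n} {q ^ n} i
           (λ j _ → q∘suc≈1 j) (λ _ _ → ≡.refl) ⟩
    (1# * q ^ n) i                ≡⟨ *-identityˡ (q ^ n) i ⟩
    (q ^ n) i                     ≡⟨ q^n-below n i i<n ⟩
    0ℤ                            ∎

open TruncatedRing using (truncated; q^n-below)

-- Instantiation at ℤ⟦q⟧ and passage to the limit.

private
  numerator : ℕ → PowerSeries
  numerator n =
    ⟨ - (q ^ 3) ⨾ q ^ 4 ⟩ (n ∸ 1) * q ^ (2 *ℕ n) * (1# + q ^ (2 *ℕ n ∸ 1))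

  summand : ℕ → PowerSeries
  summand n = numerator n / ⟨ q ^ 2 ⨾ q ^ 2 ⟩ n

  firstSummand : PowerSeries
  firstSummand = (q ^ 2 + q ^ 3) / (1# - q ^ 2)

  truncatedSeriesRing : ℕ → TruncatedSeriesRing 0ℓ 0ℓ
  truncatedSeriesRing k = record
    { ring        = truncated k
    ; _^_         = _^_
    ; ^-zero      = λ _ _ _ → ≡.refl
    ; ^-suc       = λ _ _ _ _ → ≡.refl
    ; q           = q
    ; inv         = λ n → 1# / (1# - q ^ n)
    -- Long division is exact because the constant coefficient of the divisor computes to 1.
    ; inv-inverse = λ n i _ → /-* 1# (1# - q ^ suc n) ≡.refl i
    ; k           = k
    ; q^n≈0       = λ {n} k<n i i≤k → q^n-below n i (ℕ.≤-<-trans i≤k k<n)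
    }

  module Truncated (k : ℕ) where
    open Identity (truncatedSeriesRing k) public using (P; P-stable; module Series)
    open Series
      firstSummand (λ i _ → /-* (q ^ 2 + q ^ 3) (1# - q ^ 2) ≡.refl i)
      summand (λ n i _ → /-* (numerator (suc n)) (⟨ q ^ 2 ⨾ q ^ 2 ⟩ (suc n))
        (⟨⨾⟩-constant (q ^ 2) (q ^ 2) (suc n) ≡.refl) i)
      public using (partialSum; partialSum-stable; partialSum≈P)

theorem12 : ∃[ S ] ∃[ P ]
    HasSumFrom 2
    (λ n → (⟨ - (q ^ 3) ⨾ q ^ 4 ⟩ (n ∸ 1) * q ^ (2 *ℕ n) * (1# + q ^ (2 *ℕ n ∸ 1)))
    / ⟨ q ^ 2 ⨾ q ^ 2 ⟩ n)
    S
    × HasProductFrom 1 ≢1,5,6[mod8]? (λ n → 1# / (1# - q ^ n)) P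
    × (1# + (q ^ 2 + q ^ 3) / (1# - q ^ 2) + S) ≈ P
theorem12 =
    -- Diagonal witnesses: coefficient k of each limit is taken from the partial sum or product of
    -- length k, since modulo qᵏ⁺¹ nothing changes from there on. The same k serves as the threshold
    -- of convergence.
    (λ k → Truncated.partialSum k k k)
  , (λ k → Truncated.P k k k)
  , (λ k → k , λ n k≤n → Truncated.partialSum-stable k k≤n k ℕ.≤-refl)
  , (λ k → k , λ n k≤n → Truncated.P-stable k k≤n k ℕ.≤-refl)
  , (λ k → Truncated.partialSum≈P k k ℕ.≤-refl)
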